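{- There exist functions $f$ and $h$ (from positive integers to positive reals) such that for every integer $t$, every graph $G$ with average degree at least $f(t)$ contains a $K_t$-model with at most $h(t)\cdot\log|G|$ vertices.
   Context: Graphs are finite, simple and undirected; $|G|$ denotes the number of vertices of $G$, and the average degree of $G$ is $2|E(G)|/|V(G)|$. A $K_t$-model in $G$ consists of $t$ connected subgraphs $B_1,\dots,B_t$ of $G$ (called branch sets) that are pairwise vertex-disjoint and such that for all distinct $i,j$ some vertex of $B_i$ is adjacent to some vertex of $B_j$. The number of vertices of the model is $\sum_{i=1}^t|B_i|$. Logarithms are binary. -}

module Defs where

open import Data.Nat using (ℕ; zero; suc; _+_; _*_; _^_; _≤_; _<ᵇ_)
open import Data.Bool using (Bool; true; false; _∧_; if_then_else_)
open import Data.Fin using (Fin; toℕ) renaming (zero to fzero; suc to fsuc)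
open import Data.Fin.Subset using (Subset; _∈_; ∣_∣)
open import Data.Product using (Σ; ∃; _×_; _,_)
open import Relation.Binary.PropositionalEquality using (_≡_; _≢_)
open import Relation.Nullary using (¬_)

Σ[<_]_ : (n : ℕ) → (Fin n → ℕ) → ℕ
Σ[< zero ] f = 0
Σ[< suc n ] f = f fzero + Σ[< n ] (λ i → f (fsuc i))

record Graph (n : ℕ) : Set where
  field
    adj    : Fin n → Fin n → Bool
    sym    : ∀ i j → adj i j ≡ adj j i
    irrefl : ∀ i → adj i i ≡ false

open Graph public

numEdges : ∀ {n} → Graph n → ℕ
numEdges {n} G =
  Σ[< n ] λ i → Σ[< n ] λ j →
    if (toℕ i <ᵇ toℕ j) ∧ adj G i j then 1 else 0

data WalkIn {n : ℕ} (G : Graph n) (S : Subset n) : Fin n → Fin n → Set where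
  here : ∀ {u} → u ∈ S → WalkIn G S u u
  step : ∀ {u w v} → u ∈ S → adj G u w ≡ true → WalkIn G S w v → WalkIn G S u v

Connected : ∀ {n} → Graph n → Subset n → Set
Connected {n} G S =
  (∃ λ v → v ∈ S) × (∀ u v → u ∈ S → v ∈ S → WalkIn G S u v)

record KModel {n : ℕ} (G : Graph n) (t : ℕ) : Set where
  field
    branch    : Fin t → Subset n
    connected : ∀ i → Connected G (branch i)
    disjoint  : ∀ i j → i ≢ j → ∀ v → v ∈ branch i → ¬ (v ∈ branch j)
    touching  : ∀ i j → i ≢ j →
                ∃ λ u → ∃ λ v → u ∈ branch i × v ∈ branch j × adj G u v ≡ true

open KModel public

modelSize : ∀ {n t} {G : Graph n} → KModel G t → ℕ
modelSize {t = t} M = Σ[< t ] λ i → ∣ branch M i ∣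

{-# OPTIONS --safe #-}
-- By induction on t, a graph with more than D·|V| (ordered) edges has a small
-- K_t-model none of whose branch sets is a single vertex.  Grow balls B₀ ⊆ B₁ ⊆ …
-- around an edge uv; after at most log n steps |B_{r+1}| ≤ 2|B_r|.  Partition the
-- edges touching B_r according to the first ball they touch.  If some class, the
-- edges touching B_{j+1} but not B_j, is dense on B_{j+2} ∖ B_j, it has a small
-- K_t-model by induction.  Each of its branch sets contains an edge, hence a
-- vertex of B_{j+1} ∖ B_j, and so has a neighbour in B_j; joining these
-- neighbours to uv by short paths inside B_j gives one more branch set.  If no
-- class is dense, few edges touch B_r, and deleting B_r preserves the density.
module Submission where

open import Defs
open import Data.Nat using (ℕ; zero; suc; _+_; _*_; _^_; _≤_; _<_; _≤?_; z≤n; s≤s; _<ᵇ_)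
open import Data.Nat.Properties hiding (_≟_)
open import Data.Nat.Induction using (<-wellFounded)
open import Data.Nat.Solver using (module +-*-Solver)
open import Induction.WellFounded using (Acc; acc)
open import Data.Bool using (Bool; true; false; _∧_; _∨_; not; if_then_else_)
open import Data.Bool.Properties using (∨-comm; ∧-conicalˡ; ∧-conicalʳ; ∨-conicalˡ; ∨-zeroʳ) renaming (_≟_ to _≟ᵇ_)
open import Data.Fin using (Fin; toℕ) renaming (zero to fzero; suc to fsuc)
open import Data.Fin.Properties using (_≟_; any?)
open import Data.Fin.Subset using (Subset; _∈_; ∣_∣; ⁅_⁆; _∪_; inside; outside)
open import Data.Fin.Subset.Properties using (x∈⁅x⁆; x∈⁅y⁆⇒x≡y; ∣⁅x⁆∣≡1; x∈p∪q⁻; p⊆p∪q; q⊆p∪q)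
open import Data.Vec using ([]; _∷_)
open import Data.Product using (Σ; ∃; _×_; _,_; proj₁; proj₂)
open import Data.Sum using (_⊎_; inj₁; inj₂)
open import Function using (_∘_)
open import Relation.Nullary using (¬_; Dec; yes; no; does; contradiction)
open import Relation.Nullary.Decidable using (dec-true)
open import Relation.Binary.PropositionalEquality using (_≡_; _≢_; refl; cong; cong₂; subst; trans) renaming (sym to ≡-sym)

private
  variable
    n t : ℕ

-- Finite sums and cardinalities

Σ-mono : ∀ n {f g : Fin n → ℕ} → (∀ i → f i ≤ g i) → Σ[< n ] f ≤ Σ[< n ] g
Σ-mono zero    f≤g = z≤n
Σ-mono (suc n) f≤g = +-mono-≤ (f≤g fzero) (Σ-mono n (f≤g ∘ fsuc))

Σ-distrib-+ : ∀ n (f g : Fin n → ℕ) →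
  Σ[< n ] (λ i → f i + g i) ≡ Σ[< n ] f + Σ[< n ] g
Σ-distrib-+ zero    f g = refl
Σ-distrib-+ (suc n) f g
  rewrite Σ-distrib-+ n (f ∘ fsuc) (g ∘ fsuc) =
  solve 4 (λ a b c d → a :+ b :+ (c :+ d) := a :+ c :+ (b :+ d)) refl
    (f fzero) (g fzero) (Σ[< n ] (f ∘ fsuc)) (Σ[< n ] (g ∘ fsuc))
  where open +-*-Solver

Σ-*ˡ : ∀ n c (f : Fin n → ℕ) → Σ[< n ] (λ i → c * f i) ≡ c * Σ[< n ] f
Σ-*ˡ zero    c f = ≡-sym (*-zeroʳ c)
Σ-*ˡ (suc n) c f rewrite Σ-*ˡ n c (f ∘ fsuc) = ≡-sym (*-distribˡ-+ c (f fzero) _)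

Σ-*ʳ : ∀ n (f : Fin n → ℕ) c → Σ[< n ] (λ i → f i * c) ≡ Σ[< n ] f * c
Σ-*ʳ zero    f c = refl
Σ-*ʳ (suc n) f c rewrite Σ-*ʳ n (f ∘ fsuc) c = ≡-sym (*-distribʳ-+ c (f fzero) _)

Σ-pos⇒∃ : ∀ n (f : Fin n → ℕ) → 0 < Σ[< n ] f → ∃ λ i → 0 < f i
Σ-pos⇒∃ (suc n) f 0<Σ with f fzero in eq
... | suc _ = fzero , subst (0 <_) (≡-sym eq) (s≤s z≤n)
... | zero  = let i , 0<fi = Σ-pos⇒∃ n (f ∘ fsuc) 0<Σ in fsuc i , 0<fi

𝟙 : Bool → ℕ
𝟙 b = if b then 1 else 0

𝟙-pos : ∀ {b} → 0 < 𝟙 b → b ≡ true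
𝟙-pos {true} _ = refl

𝟙-mono : ∀ {a b} → (a ≡ true → b ≡ true) → 𝟙 a ≤ 𝟙 b
𝟙-mono {false} _ = z≤n
𝟙-mono {true}  h rewrite h refl = ≤-refl

𝟙-∨ : ∀ a b → 𝟙 (a ∨ b) ≤ 𝟙 a + 𝟙 b
𝟙-∨ false b = ≤-refl
𝟙-∨ true  b = s≤s z≤n

𝟙-∧-not : ∀ a b → (b ≡ true → a ≡ true) → 𝟙 (a ∧ not b) + 𝟙 b ≤ 𝟙 a
𝟙-∧-not false false h = z≤n
𝟙-∧-not true  false h = ≤-refl
𝟙-∧-not a     true  h rewrite h refl = ≤-refl

∨-true⁻ : ∀ a {b} → a ∨ b ≡ true → a ≡ true ⊎ b ≡ true
∨-true⁻ true  _ = inj₁ refl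
∨-true⁻ false p = inj₂ p

not-true⁻ : ∀ {a} → not a ≡ true → a ≡ false
not-true⁻ {false} _ = refl

true≢false : ∀ {a} → a ≡ true → a ≡ false → ∀ {ℓ} {A : Set ℓ} → A
true≢false refl ()

-- Vertex sets that get counted are Boolean predicates, computed directly from adjacency. The type
-- `Subset` is kept for branch sets and the clusters that become one.
_∖_ : (P Q : Fin n → Bool) → Fin n → Bool
(P ∖ Q) x = P x ∧ not (Q x)

card : (Fin n → Bool) → ℕ
card {n} P = Σ[< n ] (𝟙 ∘ P)

card≤n : (P : Fin n → Bool) → card P ≤ n
card≤n {zero}  P = z≤n
card≤n {suc n} P = +-mono-≤ (𝟙≤1 (P fzero)) (card≤n (P ∘ fsuc))
  where
  𝟙≤1 : ∀ b → 𝟙 b ≤ 1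
  𝟙≤1 true  = ≤-refl
  𝟙≤1 false = z≤n

card-∖ : {P Q : Fin n → Bool} → (∀ x → Q x ≡ true → P x ≡ true) →
  card (P ∖ Q) + card Q ≤ card P
card-∖ {n} {P} {Q} Q⊆P = begin
  card (P ∖ Q) + card Q                       ≡⟨ Σ-distrib-+ n _ _ ⟨
  Σ[< n ] (λ x → 𝟙 ((P ∖ Q) x) + 𝟙 (Q x))     ≤⟨ Σ-mono n (λ x → 𝟙-∧-not (P x) (Q x) (Q⊆P x)) ⟩
  card P                                      ∎
  where open ≤-Reasoning

∈⇒0<card : {P : Fin n → Bool} (x : Fin n) → P x ≡ true → 0 < card P
∈⇒0<card fzero    Px rewrite Px = s≤s z≤n
∈⇒0<card {P = P} (fsuc x) Px = ≤-trans (∈⇒0<card x Px) (m≤n+m _ (𝟙 (P fzero)))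

card-singleton : (u : Fin n) → card (λ x → does (x ≟ u)) ≤ 1
card-singleton {suc n} fzero    = s≤s (≤-reflexive (card-∅ n))
  where
  card-∅ : ∀ n → Σ[< n ] (λ _ → 0) ≡ 0
  card-∅ zero    = refl
  card-∅ (suc n) = card-∅ n
card-singleton {suc n} (fsuc u) = card-singleton u

∣∪∣≤ : (p q : Subset n) → ∣ p ∪ q ∣ ≤ ∣ p ∣ + ∣ q ∣
∣∪∣≤ []            []            = z≤n
∣∪∣≤ (outside ∷ p) (outside ∷ q) = ∣∪∣≤ p q
∣∪∣≤ (outside ∷ p) (inside  ∷ q) =
  ≤-trans (s≤s (∣∪∣≤ p q)) (≤-reflexive (≡-sym (+-suc ∣ p ∣ ∣ q ∣)))
∣∪∣≤ (inside  ∷ p) (outside ∷ q) = s≤s (∣∪∣≤ p q)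
∣∪∣≤ (inside  ∷ p) (inside  ∷ q) =
  s≤s (≤-trans (∣∪∣≤ p q) (+-monoʳ-≤ ∣ p ∣ (n≤1+n ∣ q ∣)))

-- Edge counts and spanning subgraphs

Σ² : (Fin n → Fin n → ℕ) → ℕ
Σ² {n} f = Σ[< n ] λ x → Σ[< n ] λ y → f x y

Σ²-mono : {f g : Fin n → Fin n → ℕ} → (∀ x y → f x y ≤ g x y) → Σ² f ≤ Σ² g
Σ²-mono {n} f≤g = Σ-mono n (λ x → Σ-mono n (f≤g x))

Σ²-+ : (f g : Fin n → Fin n → ℕ) → Σ² (λ x y → f x y + g x y) ≤ Σ² f + Σ² g
Σ²-+ {n} f g = begin
  Σ² (λ x y → f x y + g x y)
    ≤⟨ Σ-mono n (λ x → ≤-reflexive (Σ-distrib-+ n (f x) (g x))) ⟩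
  Σ[< n ] (λ x → Σ[< n ] (f x) + Σ[< n ] (g x))
    ≡⟨ Σ-distrib-+ n _ _ ⟩
  Σ² f + Σ² g ∎
  where open ≤-Reasoning

Σ²-product : (f g : Fin n → ℕ) → Σ² (λ x y → f x * g y) ≤ Σ[< n ] f * Σ[< n ] g
Σ²-product {n} f g = begin
  Σ² (λ x y → f x * g y)             ≤⟨ Σ-mono n (λ x → ≤-reflexive (Σ-*ˡ n (f x) g)) ⟩
  Σ[< n ] (λ x → f x * Σ[< n ] g)    ≡⟨ Σ-*ʳ n f _ ⟩
  Σ[< n ] f * Σ[< n ] g              ∎
  where open ≤-Reasoning

-- Ordered pairs, so each edge is counted twice.
arcs : Graph n → ℕ
arcs G = Σ² λ x y → 𝟙 (adj G x y)

numEdges≤arcs : (G : Graph n) → numEdges G ≤ arcs G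
numEdges≤arcs G = Σ²-mono λ x y → 𝟙-mono (∧-conicalʳ (toℕ x <ᵇ toℕ y) (adj G x y))

arcs-pos⇒edge : (G : Graph n) → 0 < arcs G → ∃ λ u → ∃ λ v → adj G u v ≡ true
arcs-pos⇒edge {n} G 0<e =
  let u , 0<d = Σ-pos⇒∃ n _ 0<e
      v , 0<a = Σ-pos⇒∃ n _ 0<d
  in u , v , 𝟙-pos 0<a

SymmetricB : (Fin n → Fin n → Bool) → Set
SymmetricB Q = ∀ x y → Q x y ≡ Q y x

filterEdges : (G : Graph n) (Q : Fin n → Fin n → Bool) → SymmetricB Q → Graph n
filterEdges G Q Q-sym = record
  { adj    = λ x y → adj G x y ∧ Q x y
  ; sym    = λ x y → cong₂ _∧_ (sym G x y) (Q-sym x y)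
  ; irrefl = λ x → cong (_∧ Q x x) (irrefl G x)
  }

touches : (Fin n → Bool) → Fin n → Fin n → Bool
touches B x y = B x ∨ B y

touches-sym : (B : Fin n → Bool) → SymmetricB (touches B)
touches-sym B x y = ∨-comm (B x) (B y)

touching[_,_] : Graph n → (Fin n → Bool) → Graph n
touching[ G , B ] = filterEdges G (touches B) (touches-sym B)

-- Deleted vertices stay in `Fin n` as isolated vertices. With the vertex type fixed, a model of a
-- subgraph is a model of `G` without relabelling.
_-ᵛ_ : Graph n → (Fin n → Bool) → Graph n
G -ᵛ B = filterEdges G (λ x y → not (touches B x y)) (λ x y → cong not (touches-sym B x y))

layer : Graph n → (B C : Fin n → Bool) → Graph n
layer G B C = touching[ G , C ] -ᵛ B

arcs-delete : (G : Graph n) (B : Fin n → Bool) →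
  arcs G ≤ arcs (G -ᵛ B) + arcs touching[ G , B ]
arcs-delete {n} G B =
  ≤-trans (Σ²-mono λ x y → split (adj G x y) (touches B x y)) (Σ²-+ {n} _ _)
  where
  split : ∀ a q → 𝟙 a ≤ 𝟙 (a ∧ not q) + 𝟙 (a ∧ q)
  split false _     = z≤n
  split true  false = ≤-refl
  split true  true  = ≤-refl

arcs-layer : (G : Graph n) (B C : Fin n → Bool) →
  arcs touching[ G , C ] ≤ arcs touching[ G , B ] + arcs (layer G B C)
arcs-layer {n} G B C =
  ≤-trans (Σ²-mono λ x y → split (adj G x y) (touches B x y) (touches C x y)) (Σ²-+ {n} _ _)
  where
  split : ∀ a p q → 𝟙 (a ∧ q) ≤ 𝟙 (a ∧ p) + 𝟙 ((a ∧ q) ∧ not p)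
  split false _     _     = z≤n
  split true  true  true  = ≤-refl
  split true  true  false = z≤n
  split true  false true  = ≤-refl
  split true  false false = z≤n

-- As deletion leaves `Fin n` unchanged, `S` stands for the vertex set in use, and densities are
-- measured against `card S`. By symmetry of `adj` it contains both ends of every edge.
Supports : (Fin n → Bool) → Graph n → Set
Supports S G = ∀ x y → adj G x y ≡ true → S x ≡ true

supports-delete : {S : Fin n → Bool} (G : Graph n) (B : Fin n → Bool) →
  Supports S G → Supports (S ∖ B) (G -ᵛ B)
supports-delete {S = S} G B supp x y xy
  rewrite supp x y (∧-conicalˡ _ _ xy)
        | ∨-conicalˡ (B x) (B y) (not-true⁻ (∧-conicalʳ (adj G x y) _ xy)) = refl

-- Connected sets without isolated vertices

_⊑_ : Graph n → Graph n → Set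
H ⊑ G = ∀ {x y} → adj H x y ≡ true → adj G x y ≡ true

walk-mono : {H G : Graph n} {P Q : Subset n} → H ⊑ G → (∀ {x} → x ∈ P → x ∈ Q) →
  ∀ {x y} → WalkIn H P x y → WalkIn G Q x y
walk-mono H⊑G P⊆Q (here x∈P)       = here (P⊆Q x∈P)
walk-mono H⊑G P⊆Q (step x∈P xw w⇝y) = step (P⊆Q x∈P) (H⊑G xw) (walk-mono H⊑G P⊆Q w⇝y)

walk-trans : {G : Graph n} {P : Subset n} {x y z : Fin n} →
  WalkIn G P x y → WalkIn G P y z → WalkIn G P x z
walk-trans (here _)         q = q
walk-trans (step x∈P xw p) q = step x∈P xw (walk-trans p q)

connected-∪ : (G : Graph n) (P Q : Subset n) {c : Fin n} → c ∈ P → c ∈ Q →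
  Connected G P → Connected G Q → Connected G (P ∪ Q)
connected-∪ G P Q {c} c∈P c∈Q (_ , conP) (_ , conQ) =
  (c , p⊆p∪q Q c∈P) , λ x y x∈ y∈ → walk-trans (to-c x∈) (from-c y∈)
  where
  inP : ∀ {x y} → WalkIn G P x y → WalkIn G (P ∪ Q) x y
  inP = walk-mono {H = G} {G} (λ p → p) (p⊆p∪q Q)
  inQ : ∀ {x y} → WalkIn G Q x y → WalkIn G (P ∪ Q) x y
  inQ = walk-mono {H = G} {G} (λ p → p) (q⊆p∪q P Q)
  to-c : ∀ {x} → x ∈ P ∪ Q → WalkIn G (P ∪ Q) x c
  to-c x∈ with x∈p∪q⁻ P Q x∈
  ... | inj₁ x∈P = inP (conP _ _ x∈P c∈P)
  ... | inj₂ x∈Q = inQ (conQ _ _ x∈Q c∈Q)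
  from-c : ∀ {x} → x ∈ P ∪ Q → WalkIn G (P ∪ Q) c x
  from-c x∈ with x∈p∪q⁻ P Q x∈
  ... | inj₁ x∈P = inP (conP _ _ c∈P x∈P)
  ... | inj₂ x∈Q = inQ (conQ _ _ c∈Q x∈Q)

-- For a connected set this excludes exactly the singletons. It is the extra condition that carries
-- the induction: a branch set found in a layer must contain an edge of that layer.
NoIsolated : Graph n → Subset n → Set
NoIsolated G P = ∀ {x} → x ∈ P → ∃ λ y → y ∈ P × adj G x y ≡ true

-- A candidate for a new branch set, confined to `B`, with a root at which it can be glued to
-- others.
record Cluster (G : Graph n) (B : Fin n → Bool) (u : Fin n) (m : ℕ) : Set where
  field
    set        : Subset n
    isConn     : Connected G set
    noIsolated : NoIsolated G set
    within     : ∀ {x} → x ∈ set → B x ≡ true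
    root∈      : u ∈ set
    size       : ∣ set ∣ ≤ m

open Cluster

cluster-mono : {G : Graph n} {B C : Fin n → Bool} {u : Fin n} {m k : ℕ} →
  (∀ x → B x ≡ true → C x ≡ true) → m ≤ k → Cluster G B u m → Cluster G C u k
cluster-mono B⊆C m≤k c = record
  { set        = set c
  ; isConn     = isConn c
  ; noIsolated = noIsolated c
  ; within     = λ x∈ → B⊆C _ (within c x∈)
  ; root∈      = root∈ c
  ; size       = ≤-trans (size c) m≤k
  }

cluster-∪ : {G : Graph n} {B : Fin n → Bool} {u w : Fin n} {m k : ℕ} →
  (c : Cluster G B u m) (d : Cluster G B w k) → w ∈ set c → Cluster G B u (m + k)
cluster-∪ {G = G} c d w∈c = record
  { set        = set c ∪ set d
  ; isConn     = connected-∪ G (set c) (set d) w∈c (root∈ d) (isConn c) (isConn d)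
  ; noIsolated = noIso
  ; within     = λ x∈ → in-B (x∈p∪q⁻ (set c) (set d) x∈)
  ; root∈      = p⊆p∪q (set d) (root∈ c)
  ; size       = ≤-trans (∣∪∣≤ (set c) (set d)) (+-mono-≤ (size c) (size d))
  }
  where
  in-B : ∀ {x} → x ∈ set c ⊎ x ∈ set d → _
  in-B (inj₁ x∈c) = within c x∈c
  in-B (inj₂ x∈d) = within d x∈d
  noIso : NoIsolated G (set c ∪ set d)
  noIso x∈ with x∈p∪q⁻ (set c) (set d) x∈
  ... | inj₁ x∈c = let y , y∈ , xy = noIsolated c x∈c in y , p⊆p∪q (set d) y∈ , xy
  ... | inj₂ x∈d = let y , y∈ , xy = noIsolated d x∈d in y , q⊆p∪q (set c) (set d) y∈ , xy

edgeCluster : (G : Graph n) {B : Fin n → Bool} {u v : Fin n} →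
  B u ≡ true → B v ≡ true → adj G u v ≡ true →
  Σ (Cluster G B u 2) λ c → v ∈ set c
edgeCluster {n} G {B} {u} {v} Bu Bv uv = record
  { set        = P
  ; isConn     = (u , u∈) , con
  ; noIsolated = λ x∈ → noIso (∈P x∈)
  ; within     = λ x∈ → in-B (∈P x∈)
  ; root∈      = u∈
  ; size       = ≤-trans (∣∪∣≤ ⁅ u ⁆ ⁅ v ⁆) (≤-reflexive (cong₂ _+_ (∣⁅x⁆∣≡1 u) (∣⁅x⁆∣≡1 v)))
  } , v∈
  where
  P : Subset n
  P = ⁅ u ⁆ ∪ ⁅ v ⁆
  u∈ : u ∈ P
  u∈ = p⊆p∪q ⁅ v ⁆ (x∈⁅x⁆ u)
  v∈ : v ∈ P
  v∈ = q⊆p∪q ⁅ u ⁆ ⁅ v ⁆ (x∈⁅x⁆ v)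
  vu : adj G v u ≡ true
  vu = trans (sym G v u) uv
  ∈P : ∀ {x} → x ∈ P → x ≡ u ⊎ x ≡ v
  ∈P x∈ with x∈p∪q⁻ ⁅ u ⁆ ⁅ v ⁆ x∈
  ... | inj₁ x∈u = inj₁ (x∈⁅y⁆⇒x≡y u x∈u)
  ... | inj₂ x∈v = inj₂ (x∈⁅y⁆⇒x≡y v x∈v)
  noIso : ∀ {x} → x ≡ u ⊎ x ≡ v → ∃ λ y → y ∈ P × adj G x y ≡ true
  noIso (inj₁ refl) = v , v∈ , uv
  noIso (inj₂ refl) = u , u∈ , vu
  in-B : ∀ {x} → x ≡ u ⊎ x ≡ v → B x ≡ true
  in-B (inj₁ refl) = Bu
  in-B (inj₂ refl) = Bv
  con : ∀ x y → x ∈ P → y ∈ P → WalkIn G P x y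
  con x y x∈ y∈ with ∈P x∈ | ∈P y∈
  ... | inj₁ refl | inj₁ refl = here u∈
  ... | inj₁ refl | inj₂ refl = step u∈ uv (here v∈)
  ... | inj₂ refl | inj₁ refl = step v∈ vu (here u∈)
  ... | inj₂ refl | inj₂ refl = here v∈

-- Balls around an edge

module _ (G : Graph n) where

  hasNeighbourIn? : (B : Fin n → Bool) (x : Fin n) →
    Dec (∃ λ y → B y ∧ adj G y x ≡ true)
  hasNeighbourIn? B x = any? (λ y → (B y ∧ adj G y x) ≟ᵇ true)

  grow : (Fin n → Bool) → Fin n → Bool
  grow B x = B x ∨ does (hasNeighbourIn? B x)

  ⊆-grow : ∀ {B} x → B x ≡ true → grow B x ≡ true
  ⊆-grow x Bx rewrite Bx = refl

  neighbour∈grow : ∀ {B} {x y} → B x ≡ true → adj G x y ≡ true → grow B y ≡ true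
  neighbour∈grow {B} {x} {y} Bx xy
    rewrite dec-true (hasNeighbourIn? B y) (x , cong₂ _∧_ Bx xy) = ∨-zeroʳ (B y)

  ∈grow⁻ : ∀ B x → grow B x ≡ true →
    B x ≡ true ⊎ (∃ λ y → B y ≡ true × adj G y x ≡ true)
  ∈grow⁻ B x p with ∨-true⁻ (B x) p
  ... | inj₁ Bx = inj₁ Bx
  ... | inj₂ q with hasNeighbourIn? B x
  ...   | yes (y , e) = inj₂ (y , ∧-conicalˡ _ _ e , ∧-conicalʳ (B y) _ e)

  touching-supports : ∀ B → Supports (grow B) touching[ G , B ]
  touching-supports B x y xy with ∨-true⁻ (B x) (∧-conicalʳ (adj G x y) _ xy)
  ... | inj₁ Bx = ⊆-grow x Bx
  ... | inj₂ By = neighbour∈grow By (trans (sym G y x) (∧-conicalˡ _ _ xy))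

  -- An arc with an end in `B` has its other end in `grow B`, so it is a pair from `B` and `grow B`
  -- in one of the two orders.
  arcs-touching : ∀ B → arcs touching[ G , B ] ≤ 2 * (card B * card (grow B))
  arcs-touching B = begin
    arcs touching[ G , B ]
      ≤⟨ Σ²-mono bound ⟩
    Σ² (λ x y → 𝟙 (B x) * 𝟙 (grow B y) + 𝟙 (grow B x) * 𝟙 (B y))
      ≤⟨ Σ²-+ {n} _ _ ⟩
    Σ² (λ x y → 𝟙 (B x) * 𝟙 (grow B y)) + Σ² (λ x y → 𝟙 (grow B x) * 𝟙 (B y))
      ≤⟨ +-mono-≤ (Σ²-product (𝟙 ∘ B) (𝟙 ∘ grow B)) (Σ²-product (𝟙 ∘ grow B) (𝟙 ∘ B)) ⟩
    card B * card (grow B) + card (grow B) * card B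
      ≡⟨ solve 2 (λ b c → b :* c :+ c :* b := con 2 :* (b :* c)) refl (card B) (card (grow B)) ⟩
    2 * (card B * card (grow B)) ∎
    where
    open ≤-Reasoning
    open +-*-Solver
    bound : ∀ x y → 𝟙 (adj G x y ∧ touches B x y) ≤
      𝟙 (B x) * 𝟙 (grow B y) + 𝟙 (grow B x) * 𝟙 (B y)
    bound x y = cover (adj G x y) (B x) (B y) (neighbour∈grow {B})
      (λ By xy → neighbour∈grow {B} By (trans (sym G y x) xy))
      where
      cover : ∀ a b c {p q} → (b ≡ true → a ≡ true → q ≡ true) →
        (c ≡ true → a ≡ true → p ≡ true) → 𝟙 (a ∧ (b ∨ c)) ≤ 𝟙 b * 𝟙 q + 𝟙 p * 𝟙 c
      cover false _     _     _  _  = z≤n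
      cover true  false false _  _  = z≤n
      cover true  true  _     bq _  rewrite bq refl refl = s≤s z≤n
      cover true  false true  _  cp rewrite cp refl refl = ≤-refl

  module _ (u v : Fin n) where

    -- Radius 0 already contains both ends of the edge, so that clusters rooted at `u` can include a
    -- neighbour of `u`.
    ball : ℕ → Fin n → Bool
    ball zero    x = does (x ≟ u) ∨ does (x ≟ v)
    ball (suc r) = grow (ball r)

    u∈ball₀ : ball 0 u ≡ true
    u∈ball₀ rewrite dec-true (u ≟ u) refl = refl

    v∈ball₀ : ball 0 v ≡ true
    v∈ball₀ rewrite dec-true (v ≟ v) refl = ∨-zeroʳ _

    card-ball₀ : card (ball 0) ≤ 2
    card-ball₀ = begin
      card (ball 0)                                             ≤⟨ Σ-mono n (λ x → 𝟙-∨ (does (x ≟ u)) _) ⟩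
      Σ[< n ] (λ x → 𝟙 (does (x ≟ u)) + 𝟙 (does (x ≟ v)))       ≡⟨ Σ-distrib-+ n _ _ ⟩
      card (λ x → does (x ≟ u)) + card (λ x → does (x ≟ v))     ≤⟨ +-mono-≤ (card-singleton u) (card-singleton v) ⟩
      2 ∎
      where open ≤-Reasoning

    ball₀⊆ball : ∀ r x → ball 0 x ≡ true → ball r x ≡ true
    ball₀⊆ball zero    x p = p
    ball₀⊆ball (suc r) x p = ⊆-grow x (ball₀⊆ball r x p)

    card-ball-pos : ∀ r → 0 < card (ball r)
    card-ball-pos r = ∈⇒0<card u (ball₀⊆ball r u u∈ball₀)

    ball-supported : ∀ {S} → Supports S G → adj G u v ≡ true →
      ∀ r x → ball r x ≡ true → S x ≡ true
    ball-supported supp uv zero x p with x ≟ u | x ≟ v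
    ... | yes refl | _        = supp u v uv
    ... | no _     | yes refl = supp v u (trans (sym G v u) uv)
    ball-supported supp uv (suc r) x p with ∈grow⁻ (ball r) x p
    ... | inj₁ q            = ball-supported supp uv r x q
    ... | inj₂ (y , _ , yx) = supp x y (trans (sym G x y) yx)

    -- If the ball more than doubled at every radius up to `R`, then `ball (suc R)` would have at
    -- least `2 ^ suc R` vertices, more than there are.
    slow-growth : ∀ R → n < 2 ^ suc R →
      ∃ λ r → r ≤ R × card (ball (suc r)) ≤ 2 * card (ball r)
    slow-growth R n<2^ = search (suc R) 0 (+-identityʳ (suc R)) (card-ball-pos 0)
      where
      -- Here `k` is the number of radii still to be tested, and the last argument is the lower
      -- bound accumulated from the earlier doublings.
      search : ∀ k r → k + r ≡ suc R → 2 ^ r ≤ card (ball r) →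
        ∃ λ r → r ≤ R × card (ball (suc r)) ≤ 2 * card (ball r)
      search zero    r refl big =
        contradiction (≤-trans big (card≤n (ball r))) (<⇒≱ n<2^)
      search (suc k) r eq   big with card (ball (suc r)) ≤? 2 * card (ball r)
      ... | yes slow = r , ≤-trans (m≤n+m r k) (≤-reflexive (suc-injective eq)) , slow
      ... | no fast  = search k (suc r) (trans (+-suc k r) eq)
                         (≤-trans (*-monoʳ-≤ 2 big) (<⇒≤ (≰⇒> fast)))

    -- Layers of edges between successive balls

    ballLayer : ℕ → Graph n
    ballLayer j = layer G (ball j) (ball (suc j))

    shell : ℕ → Fin n → Bool
    shell j = ball (suc (suc j)) ∖ ball j

    shell-supports : ∀ j → Supports (shell j) (ballLayer j)
    shell-supports j =
      supports-delete touching[ G , ball (suc j) ] (ball j) (touching-supports (ball (suc j)))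

    -- If every layer is sparse, their bounds are summed. The size of shell `j` is at most the
    -- difference between the balls of radii `j + 2` and `j`, so the total telescopes into the last
    -- two balls.
    dense-layer : ∀ D → 4 ≤ D → ∀ r →
      (∃ λ j → j < r × D * card (shell j) < arcs (ballLayer j)) ⊎
      arcs touching[ G , ball r ] ≤ D * (card (ball r) + card (ball (suc r)))
    -- `ball 0` has at most two vertices, so at most `4 * card (ball 1)` arcs touch it; hence the
    -- requirement `4 ≤ D`.
    dense-layer D 4≤D zero = inj₂ (begin
      arcs touching[ G , ball 0 ]             ≤⟨ arcs-touching (ball 0) ⟩
      2 * (card (ball 0) * card (ball 1))     ≤⟨ *-monoʳ-≤ 2 (*-monoˡ-≤ (card (ball 1)) card-ball₀) ⟩
      2 * (2 * card (ball 1))                 ≡⟨ *-assoc 2 2 (card (ball 1)) ⟨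
      4 * card (ball 1)                       ≤⟨ *-mono-≤ 4≤D (m≤n+m (card (ball 1)) (card (ball 0))) ⟩
      D * (card (ball 0) + card (ball 1))     ∎)
      where open ≤-Reasoning
    dense-layer D 4≤D (suc r) with dense-layer D 4≤D r
    ... | inj₁ (j , j<r , dense) = inj₁ (j , m<n⇒m<1+n j<r , dense)
    ... | inj₂ few with arcs (ballLayer r) ≤? D * card (shell r)
    ...   | no dense   = inj₁ (r , ≤-refl , ≰⇒> dense)
    ...   | yes sparse = inj₂ (begin
      arcs touching[ G , ball (suc r) ]
        ≤⟨ arcs-layer G (ball r) (ball (suc r)) ⟩
      arcs touching[ G , ball r ] + arcs (ballLayer r)
        ≤⟨ +-mono-≤ few sparse ⟩
      D * (b + b₁) + D * card (shell r)
        ≡⟨ solve 4 (λ d b b₁ s → d :* (b :+ b₁) :+ d :* s := d :* (b₁ :+ (s :+ b))) refl D b b₁ (card (shell r)) ⟩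
      D * (b₁ + (card (shell r) + b))
        -- Shell `r` and `ball r` are disjoint parts of `ball (suc (suc r))`, which moves the bound
        -- on by one radius.
        ≤⟨ *-monoʳ-≤ D (+-monoʳ-≤ b₁ (card-∖ (λ x p → ⊆-grow x (⊆-grow x p)))) ⟩
      D * (b₁ + card (ball (suc (suc r)))) ∎)
      where
      open ≤-Reasoning
      open +-*-Solver
      b b₁ : ℕ
      b  = card (ball r)
      b₁ = card (ball (suc r))

    -- Short connected sets inside a ball

    module _ (uv : adj G u v ≡ true) where

      rootCluster : ∀ r → Cluster G (ball r) u 2
      rootCluster r =
        proj₁ (edgeCluster G (ball₀⊆ball r u u∈ball₀) (ball₀⊆ball r v v∈ball₀) uv)

      -- Going back from `x` towards `uv` adds at most one edge per radius. Each edge is charged two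
      -- vertices although it shares one with the rest; with the initial edge this makes
      -- `2 * suc r`.
      path : ∀ r x → ball r x ≡ true →
        Σ (Cluster G (ball r) u (2 * suc r)) λ c → x ∈ set c
      path zero x p with x ≟ u | x ≟ v
      ... | yes refl | _        = rootCluster 0 , root∈ (rootCluster 0)
      ... | no _     | yes refl = edgeCluster G u∈ball₀ v∈ball₀ uv
      path (suc r) x p with ∈grow⁻ (ball r) x p
      ... | inj₁ q =
        let c , x∈ = path r x q
        in cluster-mono ⊆-grow (*-monoʳ-≤ 2 (n≤1+n (suc r))) c , x∈
      ... | inj₂ (y , q , yx) =
        let c , y∈ = path r y q
            d , x∈ = edgeCluster G (⊆-grow y q) (neighbour∈grow q yx) yx
            e = cluster-∪ (cluster-mono ⊆-grow ≤-refl c) d y∈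
        in cluster-mono (λ _ p → p) (≤-reflexive 2+) e , q⊆p∪q (set c) (set d) x∈
        where
        open +-*-Solver
        2+ : 2 * suc r + 2 ≡ 2 * suc (suc r)
        2+ = solve 1 (λ r → con 2 :* (con 1 :+ r) :+ con 2 := con 2 :* (con 2 :+ r)) refl r

      -- Paths to the `z k` are glued at their common root `u`. The recursion ends with the edge
      -- `uv`, so even for `t = 0` the set is a valid cluster, and `suc t` counts this edge as one
      -- more path.
      joining : ∀ r t (z : Fin t → Fin n) → (∀ k → ball r (z k) ≡ true) →
        Σ (Cluster G (ball r) u (suc t * (2 * suc r))) λ c → ∀ k → z k ∈ set c
      joining r zero    z z∈ =
        cluster-mono (λ _ p → p) (≤-trans (*-monoʳ-≤ 2 (s≤s z≤n)) (m≤m+n _ 0)) (rootCluster r) , λ ()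
      joining r (suc t) z z∈ =
        let c , z₀∈ = path r (z fzero) (z∈ fzero)
            d , zs∈ = joining r t (z ∘ fsuc) (z∈ ∘ fsuc)
        in cluster-∪ c d (root∈ c) ,
           λ { fzero    → p⊆p∪q (set d) z₀∈
             ; (fsuc k) → q⊆p∪q (set c) (set d) (zs∈ k) }

-- Small models

SmallModel : Graph n → (t m : ℕ) → Set
SmallModel G t m =
  Σ (KModel G t) λ M → (∀ k → NoIsolated G (branch M k)) × modelSize M ≤ m

smallModel-mono : {H G : Graph n} {m : ℕ} → H ⊑ G → SmallModel H t m → SmallModel G t m
smallModel-mono {H = H} {G} H⊑G (M , noIso , small) =
  record
    { branch    = branch M
    ; connected = λ k → proj₁ (connected M k) ,
        λ x y x∈ y∈ → walk-mono {H = H} {G} H⊑G (λ p → p) (proj₂ (connected M k) x y x∈ y∈)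
    ; disjoint  = disjoint M
    ; touching  = λ i j i≢j →
        let x , y , x∈ , y∈ , xy = touching M i j i≢j in x , y , x∈ , y∈ , H⊑G xy
    } ,
  (λ k x∈ → let y , y∈ , xy = noIso k x∈ in y , y∈ , H⊑G xy) ,
  small

emptyModel : (G : Graph n) → SmallModel G 0 0
emptyModel G =
  record { branch = λ () ; connected = λ () ; disjoint = λ () ; touching = λ () } ,
  (λ ()) , z≤n

-- `B` separates the new branch set, which lies inside it, from the old ones, which avoid it.
extendModel : {G : Graph n} {B : Fin n → Bool} {u : Fin n} {m k : ℕ}
  ((M , _) : SmallModel G t m) (c : Cluster G B u k) →
  (∀ i {x} → x ∈ branch M i → B x ≡ false) →
  (∀ i → ∃ λ x → ∃ λ y → x ∈ set c × y ∈ branch M i × adj G x y ≡ true) →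
  SmallModel G (suc t) (k + m)
extendModel {n} {t} {G} {B} (M , noIso , small) c avoid touch =
  record { branch = br ; connected = con ; disjoint = dis ; touching = tou } ,
  (λ { fzero → noIsolated c ; (fsuc i) → noIso i }) ,
  +-mono-≤ (size c) small
  where
  br : Fin (suc t) → Subset n
  br fzero    = set c
  br (fsuc i) = branch M i
  con : ∀ i → Connected G (br i)
  con fzero    = isConn c
  con (fsuc i) = connected M i
  dis : ∀ i j → i ≢ j → ∀ v → v ∈ br i → ¬ (v ∈ br j)
  dis fzero    fzero    i≢j v p q = contradiction refl i≢j
  dis fzero    (fsuc j) i≢j v p q = true≢false (within c p) (avoid j q)
  dis (fsuc i) fzero    i≢j v p q = true≢false (within c q) (avoid i p)
  dis (fsuc i) (fsuc j) i≢j       = disjoint M i j (i≢j ∘ cong fsuc)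
  tou : ∀ i j → i ≢ j → ∃ λ x → ∃ λ y → x ∈ br i × y ∈ br j × adj G x y ≡ true
  tou fzero    fzero    i≢j = contradiction refl i≢j
  tou fzero    (fsuc j) i≢j = touch j
  tou (fsuc i) fzero    i≢j =
    let x , y , x∈ , y∈ , xy = touch i in y , x , y∈ , x∈ , trans (sym G y x) xy
  tou (fsuc i) (fsuc j) i≢j = touching M i j (i≢j ∘ cong fsuc)

layer-model : (G : Graph n) (u v : Fin n) → adj G u v ≡ true → ∀ j {m} →
  SmallModel (ballLayer G u v j) t m → SmallModel G (suc t) (suc t * (2 * suc j) + m)
layer-model {n} {t} G u v uv j (M , noIso , small) =
  extendModel (smallModel-mono H⊑G (M , noIso , small)) c avoid
    (λ i → let w , w∈ , z , z∈ , zw = contact i in z , w , c∋ i , w∈ , zw)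
  where
  B C : Fin n → Bool
  B = ball G u v j
  C = ball G u v (suc j)
  H : Graph n
  H = ballLayer G u v j
  H⊑G : H ⊑ G
  H⊑G = ∧-conicalˡ _ _ ∘ ∧-conicalˡ _ _
  outsideB : ∀ {x y} → adj H x y ≡ true → B x ≡ false
  outsideB {x} {y} xy =
    ∨-conicalˡ _ _ (not-true⁻ (∧-conicalʳ (adj G x y ∧ touches C x y) _ xy))
  -- `NoIsolated` puts `x` on an edge of the layer, and no such edge meets `B`.
  avoid : ∀ i {x} → x ∈ branch M i → B x ≡ false
  avoid i x∈ = let y , _ , xy = noIso i x∈ in outsideB xy
  -- A branch set contains both ends of some edge of the layer; that edge touches `C`, so one of its
  -- ends lies in `C`.
  inC : ∀ i → ∃ λ w → w ∈ branch M i × C w ≡ true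
  inC i with proj₁ (connected M i)
  ... | x , x∈ with noIso i x∈
  ...   | y , y∈ , xy
    with ∨-true⁻ (C x) (∧-conicalʳ (adj G x y) _ (∧-conicalˡ _ _ xy))
  ...     | inj₁ Cx = x , x∈ , Cx
  ...     | inj₂ Cy = y , y∈ , Cy
  contact : ∀ i → ∃ λ w → w ∈ branch M i × ∃ λ z → B z ≡ true × adj G z w ≡ true
  contact i with inC i
  ... | w , w∈ , Cw with ∈grow⁻ G B w Cw
  ...   | inj₁ Bw = true≢false Bw (avoid i w∈)
  ...   | inj₂ z  = w , w∈ , z
  joined = joining G u v uv j t
    (λ i → proj₁ (proj₂ (proj₂ (contact i))))
    (λ i → proj₁ (proj₂ (proj₂ (proj₂ (contact i)))))
  c  = proj₁ joined
  c∋ = proj₂ joined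

-- Density increment

-- The bound `m` is the same for all `S`, while density is relative to `S`. The hypothesis can
-- therefore be applied to a layer supported on a small shell.
DenseHasModel : (n t D m : ℕ) → Set
DenseHasModel n t D m = (G : Graph n) (S : Fin n → Bool) → Supports S G →
  D * card S < arcs G → SmallModel G t m

-- The factor 3 comes from a slow radius, where two successive balls together have at most three
-- times the size of the inner one: deleting the ball loses at most `3 * D` arcs per deleted vertex.
-- The recursion is on `card S`, which drops because the ball is nonempty.
dense-step : ∀ R {t D m} → n < 2 ^ suc R → 4 ≤ D →
  DenseHasModel n t D m → DenseHasModel n (suc t) (3 * D) (suc t * (2 * suc R) + m)
dense-step {n} R {t} {D} {m} n<2^ 4≤D ih G S supp dense = go G S supp dense (<-wellFounded _)
  where
  go : (G : Graph n) (S : Fin n → Bool) → Supports S G → 3 * D * card S < arcs G →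
    Acc _<_ (card S) → SmallModel G (suc t) (suc t * (2 * suc R) + m)
  -- Strictness of `dense` yields at least one arc, hence an edge around which to grow balls.
  go G S supp dense (acc rec) with arcs-pos⇒edge G (≤-<-trans z≤n dense)
  ... | u , v , uv with slow-growth G u v R n<2^
  ... | r , r≤R , slow with dense-layer G u v D 4≤D r
  ... | inj₁ (j , j<r , denseⱼ) =
    let M , noIso , small = layer-model G u v uv j
          (ih (ballLayer G u v j) (shell G u v j) (shell-supports G u v j) denseⱼ)
    in M , noIso , ≤-trans small
         (+-monoˡ-≤ m (*-monoʳ-≤ (suc t) (*-monoʳ-≤ 2 (s≤s (<⇒≤ (<-≤-trans j<r r≤R))))))
  ... | inj₂ few =
    smallModel-mono {H = G -ᵛ B} {G} (∧-conicalˡ _ _)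
      (go (G -ᵛ B) (S ∖ B) (supports-delete G B supp) dense′ (rec smaller))
    where
    open ≤-Reasoning
    open +-*-Solver
    B : Fin n → Bool
    B = ball G u v r
    s+b≤ : card (S ∖ B) + card B ≤ card S
    s+b≤ = card-∖ (ball-supported G u v supp uv r)
    smaller : card (S ∖ B) < card S
    smaller = <-≤-trans (m<m+n _ (card-ball-pos G u v r)) s+b≤
    few′ : arcs touching[ G , B ] ≤ 3 * D * card B
    few′ = begin
      arcs touching[ G , B ]                         ≤⟨ few ⟩
      D * (card B + card (ball G u v (suc r)))       ≤⟨ *-monoʳ-≤ D (+-monoʳ-≤ (card B) slow) ⟩
      D * (card B + 2 * card B)                      ≡⟨ solve 2 (λ d b → d :* (b :+ con 2 :* b) := con 3 :* d :* b) refl D (card B) ⟩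
      3 * D * card B                                 ∎
    dense′ : 3 * D * card (S ∖ B) < arcs (G -ᵛ B)
    dense′ = +-cancelʳ-< (3 * D * card B) _ _ (begin-strict
      3 * D * card (S ∖ B) + 3 * D * card B          ≡⟨ *-distribˡ-+ (3 * D) (card (S ∖ B)) (card B) ⟨
      3 * D * (card (S ∖ B) + card B)                ≤⟨ *-monoʳ-≤ (3 * D) s+b≤ ⟩
      3 * D * card S                                 <⟨ dense ⟩
      arcs G                                         ≤⟨ arcs-delete G B ⟩
      arcs (G -ᵛ B) + arcs touching[ G , B ]         ≤⟨ +-monoʳ-≤ (arcs (G -ᵛ B)) few′ ⟩
      arcs (G -ᵛ B) + 3 * D * card B                 ∎)

-- This is `4 * 3 ^ t`: the 4 meets the hypothesis `4 ≤ D`, and each `dense-step` costs a factor 3.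
density : ℕ → ℕ
density zero    = 4
density (suc t) = 3 * density t

4≤density : ∀ t → 4 ≤ density t
4≤density zero    = ≤-refl
4≤density (suc t) = ≤-trans (4≤density t) (m≤m+n _ _)

-- The triangular numbers: passing from `t` to `suc t` adds a branch set charged as `suc t` pieces
-- of `2 * suc R` vertices each.
pathCount : ℕ → ℕ
pathCount zero    = 0
pathCount (suc t) = suc t + pathCount t

dense-model : ∀ R → n < 2 ^ suc R → ∀ t →
  DenseHasModel n t (density t) (pathCount t * (2 * suc R))
dense-model R n<2^ zero    G S supp dense = emptyModel G
dense-model R n<2^ (suc t) =
  subst (DenseHasModel _ (suc t) (density (suc t)))
    (≡-sym (*-distribʳ-+ (2 * suc R) (suc t) (pathCount t)))
    (dense-step R n<2^ (4≤density t) (dense-model R n<2^ t))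

-- Logarithms and the average degree bound

floor-log₂ : ∀ n → ∃ λ R → 2 ^ R ≤ suc n × suc n < 2 ^ suc R
floor-log₂ zero = 0 , ≤-refl , ≤-refl
floor-log₂ (suc n) with floor-log₂ n
... | R , lo , hi with m≤n⇒m<n∨m≡n hi
...   | inj₁ <2^ = R , m≤n⇒m≤1+n lo , <2^
...   | inj₂ ≡2^ = suc R , ≤-reflexive (≡-sym ≡2^) ,
        subst (_< 2 ^ suc (suc R)) (≡-sym ≡2^) (^-monoʳ-< 2 (s≤s (s≤s z≤n)) (n<1+n (suc R)))

theorem1p1 : Σ (ℕ → ℕ) λ f → Σ (ℕ → ℕ) λ h →
    ((t : ℕ) → 1 ≤ f t × 1 ≤ h t) ×
    ((t : ℕ) → 1 ≤ t → (n : ℕ) → 1 ≤ n → (G : Graph n) →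
    f t * n ≤ 2 * numEdges G →
    Σ (KModel G t) λ M → 2 ^ modelSize M ≤ n ^ h t)
theorem1p1 = f , h , (λ t → s≤s z≤n , s≤s z≤n) , main
  where
  f h : ℕ → ℕ
  -- The 2 cancels against the one in the average degree; the successor makes the inequality `dense`
  -- strict.
  f t = 2 * suc (density t)
  -- The successor keeps `h` positive at `t = 0`, where `pathCount` vanishes.
  h t = suc (4 * pathCount t)
  main : (t : ℕ) → 1 ≤ t → (n : ℕ) → 1 ≤ n → (G : Graph n) →
    f t * n ≤ 2 * numEdges G →
    Σ (KModel G t) λ M → 2 ^ modelSize M ≤ n ^ h t
  -- A single vertex has no edges, while `f t` is positive. For the remaining `n`, at least 2, the
  -- logarithm `R` is at least 1.
  main t _ (suc zero)         _ G ()
  main t _ n@(suc (suc n₀)) _ G edges with floor-log₂ (suc n₀)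
  ... | zero  , _  , s≤s (s≤s ())
  ... | R@(suc R₀) , lo , hi =
    let M , _ , small = dense-model R hi t G (λ _ → true) (λ _ _ _ → refl) dense
    in M , bound small
    where
    open ≤-Reasoning
    open +-*-Solver
    dense : density t * card {n} (λ _ → true) < arcs G
    dense = begin-strict
      density t * card {n} (λ _ → true)   ≤⟨ *-monoʳ-≤ (density t) (card≤n {n} (λ _ → true)) ⟩
      density t * n                       <⟨ m<n+m (density t * n) (s≤s z≤n) ⟩
      suc (density t) * n                 ≤⟨ *-cancelˡ-≤ 2 (≤-trans (≤-reflexive (≡-sym (*-assoc 2 (suc (density t)) n))) edges) ⟩
      numEdges G                          ≤⟨ numEdges≤arcs G ⟩
      arcs G                              ∎
    -- Since `R` is at least 1, the additive 1 in `suc R` is absorbed into the constant.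
    2+2R≤4R : 2 * suc R ≤ R * 4
    2+2R≤4R = begin
      2 * suc R         ≤⟨ *-monoʳ-≤ 2 (+-monoˡ-≤ R (s≤s (z≤n {R₀}))) ⟩
      2 * (R + R)       ≡⟨ solve 1 (λ r → con 2 :* (r :+ r) := r :* con 4) refl R ⟩
      R * 4             ∎
    -- The logarithmic bound in exponential form: exponents of 2 are compared first, then `2 ^ R` is
    -- replaced by `n`.
    bound : ∀ {s} → s ≤ pathCount t * (2 * suc R) → 2 ^ s ≤ n ^ h t
    bound {s} small = begin
      2 ^ s                              ≤⟨ ^-monoʳ-≤ 2 small ⟩
      2 ^ (pathCount t * (2 * suc R))    ≤⟨ ^-monoʳ-≤ 2 (*-monoʳ-≤ (pathCount t) 2+2R≤4R) ⟩
      2 ^ (pathCount t * (R * 4))        ≡⟨ cong (2 ^_) (solve 2 (λ p r → p :* (r :* con 4) := r :* (con 4 :* p)) refl (pathCount t) R) ⟩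
      2 ^ (R * (4 * pathCount t))        ≡⟨ ^-*-assoc 2 R (4 * pathCount t) ⟨
      (2 ^ R) ^ (4 * pathCount t)        ≤⟨ ^-monoˡ-≤ (4 * pathCount t) lo ⟩
      n ^ (4 * pathCount t)              ≤⟨ ^-monoʳ-≤ n (n≤1+n (4 * pathCount t)) ⟩
      n ^ h t                            ∎
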